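{- Let $G=(V,E)$ be a graph that belongs to the class $\mathcal{F}$ and has at least two vertices, and let $X\subseteq V$ be the set of cut vertices of $G$. Then $\mathrm{evc}(G)=\mathrm{mvc}(G)$ if and only if for every vertex $v\in V\setminus X$ there exists a minimum vertex cover $S_v$ of $G$ such that $X\cup\{v\}\subseteq S_v$.
   Context: All graphs are finite and simple. $\mathrm{mvc}(G)$ denotes the minimum cardinality of a vertex cover of $G$. A vertex cover $S$ is connected if the induced subgraph $G[S]$ is connected. Eternal vertex cover game: guards are placed on vertices of $G$, at most one guard per vertex; the set of occupied vertices is a configuration. In each round an attacker chooses an edge $uv$; the defender responds by moving guards simultaneously, each guard either staying put or moving to an adjacent vertex, such that at least one guard moves across the attacked edge (from one endpoint to the other), and after the move at most one guard is on each vertex; the number of guards never changes. An eternal vertex cover class of $G$ is a family $\mathcal{C}$ of vertex covers of $G$, all of the same cardinality, such that for every configuration $S\in\mathcal{C}$ and every attacked edge, the attack can be defended by a legal move leading to a configuration in $\mathcal{C}$. The eternal vertex cover number $\mathrm{evc}(G)$ is the minimum cardinality of a configuration of an eternal vertex cover class of $G$. The class $\mathcal{F}$ consists of all connected graphs $G$ such that every minimum vertex cover of $G$ that contains all cut vertices of $G$ induces a connected subgraph of $G$. -}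

module Defs where

open import Level using (0ℓ)
open import Data.Nat using (ℕ; _≤_)
open import Data.Fin using (Fin)
open import Data.Fin.Subset using (Subset; _∈_; ∣_∣; ⊤; _-_)
open import Data.Product using (Σ; ∃; _×_; _,_)
open import Data.Sum using (_⊎_)
open import Relation.Nullary using (¬_)
open import Relation.Binary.PropositionalEquality using (_≡_; _≢_)

record Graph (n : ℕ) : Set₁ where
  field
    Adj   : Fin n → Fin n → Set
    sym   : ∀ {u v} → Adj u v → Adj v u
    irrefl : ∀ {u} → ¬ Adj u u

module _ {n : ℕ} (G : Graph n) where
  open Graph G

  VertexCover : Subset n → Set
  VertexCover S = ∀ u v → Adj u v → u ∈ S ⊎ v ∈ S

  MinVC : Subset n → Set
  MinVC S = VertexCover S × (∀ T → VertexCover T → ∣ S ∣ ≤ ∣ T ∣)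

  IsMVC : ℕ → Set
  IsMVC k = Σ (Subset n) (λ S → MinVC S × ∣ S ∣ ≡ k)

  data Reach (S : Subset n) (x : Fin n) : Fin n → Set where
    here : x ∈ S → Reach S x x
    step : ∀ {y z} → Reach S x y → Adj y z → z ∈ S → Reach S x z

  ConnectedSet : Subset n → Set
  ConnectedSet S = ∀ x y → x ∈ S → y ∈ S → Reach S x y

  Connected : Set
  Connected = ConnectedSet ⊤

  -- x is a cut vertex: removing x increases the number of components,
  -- i.e. two vertices different from x, connected in G, become
  -- disconnected in G - x.
  CutVertex : Fin n → Set
  CutVertex x = Σ (Fin n) λ a → Σ (Fin n) λ b →
    a ≢ x × b ≢ x × Reach ⊤ a b × ¬ Reach (⊤ - x) a b

  InF : Set
  InF = Connected ×
        (∀ S → MinVC S → (∀ x → CutVertex x → x ∈ S) → ConnectedSet S)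

  -- A legal move from configuration S to S' defending the attack on
  -- edge uv: the guard on x ∈ S moves to f x (staying or moving to a
  -- neighbour), guards end on distinct vertices, S' is the set of
  -- occupied vertices afterwards, and some guard crosses uv.
  Move : Subset n → Subset n → Fin n → Fin n → Set
  Move S S' u v = Σ (Fin n → Fin n) λ f →
      (∀ x → x ∈ S → f x ≡ x ⊎ Adj x (f x))
    × (∀ x y → x ∈ S → y ∈ S → f x ≡ f y → x ≡ y)
    × (∀ y → y ∈ S' → Σ (Fin n) λ x → x ∈ S × f x ≡ y)
    × (∀ x → x ∈ S → f x ∈ S')
    × ((u ∈ S × f u ≡ v) ⊎ (v ∈ S × f v ≡ u))

  EVCClass : (Subset n → Set) → Set
  EVCClass C =
      (∀ S → C S → VertexCover S)
    × (∀ S T → C S → C T → ∣ S ∣ ≡ ∣ T ∣)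
    × (∀ S → C S → ∀ u v → Adj u v → Σ (Subset n) λ S' → C S' × Move S S' u v)

  IsEVC : ℕ → Set₁
  IsEVC k =
      (Σ (Subset n → Set) λ C → EVCClass C × Σ (Subset n) λ S → C S × ∣ S ∣ ≡ k)
    × (∀ (C : Subset n → Set) → EVCClass C → ∀ S → C S → k ≤ ∣ S ∣)

{-# OPTIONS --safe #-}

-- (⇒) Let x be a cut vertex outside a configuration S of an eternal class of
-- minimum covers, and split G - x into two sides without edges between them.
-- Attacking an edge from x to a side pulls one guard of that side onto x and
-- leaves the other side alone.  So each side can be covered with one guard
-- fewer than S uses there, and adding x to these two covers gives a vertex
-- cover of size ∣ S ∣ - 1.  Hence all configurations contain all cut vertices,
-- and attacking an edge at v produces a configuration that also contains v.
--
-- (⇐) The minimum covers containing all cut vertices form an eternal class.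
-- When the guard on u ∈ S must move to v, take such a cover S' ∋ v and look for
-- an injection S' - v → S - u along edges and loops.  If Hall's condition fails
-- for Q ⊆ S' - v, let D be the closed neighbourhood of Q in S.  Then
-- (S' ─ Q) ∪ D is again an admissible target, and it is closer to S, unless
-- Q = D; in that case Q is closed under adjacency in S and contains u, which is
-- impossible because S is connected and Q is smaller than S.
module Submission where

open import Defs
open import Data.Nat using (ℕ; zero; suc; _+_; _≤_; _<_; z≤n; s≤s; s≤s⁻¹)
open import Data.Nat.Properties as ℕₚ using (module ≤-Reasoning)
open import Data.Nat.Induction using (Acc; acc; <-wellFounded)
open import Data.Fin using (Fin; zero; suc)
open import Data.Fin.Properties using (_≟_; any?; sequence)
open import Data.Fin.Subset
  using (Subset; Empty; inside; outside; _∈_; _∉_; _⊆_; _⊂_; ∣_∣; ⊤; ∁; ⁅_⁆; _∪_; _∩_; _─_; _-_)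
open import Data.Fin.Subset.Properties
open import Data.Empty using (⊥-elim)
open import Data.Product using (Σ; ∃; _×_; _,_; proj₁; proj₂)
open import Data.Sum using (_⊎_; inj₁; inj₂; [_,_]; map₂)
open import Data.Vec using ([]; _∷_; tabulate; here; there)
open import Data.Vec.Properties using (lookup∘tabulate; lookup⇒[]=; []=⇒lookup)
open import Effect.Monad using (RawMonad)
open import Function using (id; _∘_)
open import Function.Bundles using (_⇔_; mk⇔)
open import Relation.Binary.PropositionalEquality
  using (_≡_; _≢_; refl; sym; trans; cong; subst)
open import Relation.Nullary using (¬_; Dec; yes; no; does; contradiction)
open import Relation.Nullary.Decidable
  using (dec-true; decidable-stable; ¬¬-excluded-middle; _×-dec_; _⊎-dec_; ¬?)
open import Relation.Nullary.Negation using (¬¬-Monad)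
open import Relation.Unary using (Pred; Decidable)

private variable
  n : ℕ

-- Finite subsets

x∈p─q⇒x∉q : ∀ (p q : Subset n) {x} → x ∈ p ─ q → x ∉ q
x∈p─q⇒x∉q (_ ∷ p) (_ ∷ q) (there x∈) (there x∈q) = x∈p─q⇒x∉q p q x∈ x∈q

x∈p-y⇒x≢y : ∀ (p : Subset n) {x} y → x ∈ p - y → x ≢ y
x∈p-y⇒x≢y p y x∈ refl = x∈p─q⇒x∉q p ⁅ y ⁆ x∈ (x∈⁅x⁆ y)

∣p∪q∣≤∣p∣+∣q∣ : ∀ (p q : Subset n) → ∣ p ∪ q ∣ ≤ ∣ p ∣ + ∣ q ∣
∣p∪q∣≤∣p∣+∣q∣ []            []            = z≤n
∣p∪q∣≤∣p∣+∣q∣ (outside ∷ p) (outside ∷ q) = ∣p∪q∣≤∣p∣+∣q∣ p q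
∣p∪q∣≤∣p∣+∣q∣ (outside ∷ p) (inside ∷ q)
  rewrite ℕₚ.+-suc ∣ p ∣ ∣ q ∣ = s≤s (∣p∪q∣≤∣p∣+∣q∣ p q)
∣p∪q∣≤∣p∣+∣q∣ (inside ∷ p)  (outside ∷ q) = s≤s (∣p∪q∣≤∣p∣+∣q∣ p q)
∣p∪q∣≤∣p∣+∣q∣ (inside ∷ p)  (inside ∷ q)  =
  s≤s (ℕₚ.≤-trans (∣p∪q∣≤∣p∣+∣q∣ p q) (ℕₚ.+-monoʳ-≤ ∣ p ∣ (ℕₚ.n≤1+n ∣ q ∣)))

disjoint⇒∣p∣+∣q∣≤∣p∪q∣ : ∀ (p q : Subset n) → (∀ {x} → x ∈ p → x ∉ q) →
  ∣ p ∣ + ∣ q ∣ ≤ ∣ p ∪ q ∣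
disjoint⇒∣p∣+∣q∣≤∣p∪q∣ []            []            _  = z≤n
disjoint⇒∣p∣+∣q∣≤∣p∪q∣ (outside ∷ p) (outside ∷ q) p# =
  disjoint⇒∣p∣+∣q∣≤∣p∪q∣ p q (λ x∈p x∈q → p# (there x∈p) (there x∈q))
disjoint⇒∣p∣+∣q∣≤∣p∪q∣ (outside ∷ p) (inside ∷ q)  p#
  rewrite ℕₚ.+-suc ∣ p ∣ ∣ q ∣ =
  s≤s (disjoint⇒∣p∣+∣q∣≤∣p∪q∣ p q (λ x∈p x∈q → p# (there x∈p) (there x∈q)))
disjoint⇒∣p∣+∣q∣≤∣p∪q∣ (inside ∷ p)  (outside ∷ q) p# =
  s≤s (disjoint⇒∣p∣+∣q∣≤∣p∪q∣ p q (λ x∈p x∈q → p# (there x∈p) (there x∈q)))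
disjoint⇒∣p∣+∣q∣≤∣p∪q∣ (inside ∷ p)  (inside ∷ q)  p# = contradiction here (p# here)

p⊆q∪r⇒∣p∣≤∣q∣+∣r∣ : ∀ {p : Subset n} (q r : Subset n) → p ⊆ q ∪ r →
  ∣ p ∣ ≤ ∣ q ∣ + ∣ r ∣
p⊆q∪r⇒∣p∣≤∣q∣+∣r∣ q r p⊆ = ℕₚ.≤-trans (p⊆q⇒∣p∣≤∣q∣ p⊆) (∣p∪q∣≤∣p∣+∣q∣ q r)

p⊆q∪⁅x⁆⇒∣p∣≤1+∣q∣ : ∀ {p : Subset n} (q : Subset n) x → p ⊆ q ∪ ⁅ x ⁆ →
  ∣ p ∣ ≤ suc ∣ q ∣
p⊆q∪⁅x⁆⇒∣p∣≤1+∣q∣ {p = p} q x p⊆ = begin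
  ∣ p ∣             ≤⟨ p⊆q∪r⇒∣p∣≤∣q∣+∣r∣ q ⁅ x ⁆ p⊆ ⟩
  ∣ q ∣ + ∣ ⁅ x ⁆ ∣ ≡⟨ cong (∣ q ∣ +_) (∣⁅x⁆∣≡1 x) ⟩
  ∣ q ∣ + 1         ≡⟨ ℕₚ.+-comm ∣ q ∣ 1 ⟩
  suc ∣ q ∣         ∎
  where open ≤-Reasoning

p⊆p-x∪⁅x⁆ : ∀ (p : Subset n) x → p ⊆ (p - x) ∪ ⁅ x ⁆
p⊆p-x∪⁅x⁆ p x {y} y∈p with y ≟ x
... | yes refl = x∈p∪q⁺ (inj₂ (x∈⁅x⁆ x))
... | no y≢x   = x∈p∪q⁺ (inj₁ (x∈p∧x≢y⇒x∈p-y y∈p y≢x))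

∣p∣≤1+∣p-x∣ : ∀ (p : Subset n) x → ∣ p ∣ ≤ suc ∣ p - x ∣
∣p∣≤1+∣p-x∣ p x = p⊆q∪⁅x⁆⇒∣p∣≤1+∣q∣ (p - x) x (p⊆p-x∪⁅x⁆ p x)

∣p─q∣+∣q∣≤∣p∣ : ∀ {p q : Subset n} → q ⊆ p → ∣ p ─ q ∣ + ∣ q ∣ ≤ ∣ p ∣
∣p─q∣+∣q∣≤∣p∣ {p = p} {q} q⊆p = ℕₚ.≤-trans
  (disjoint⇒∣p∣+∣q∣≤∣p∪q∣ (p ─ q) q (x∈p─q⇒x∉q p q))
  (p⊆q⇒∣p∣≤∣q∣ ([ p─q⊆p p q , q⊆p ] ∘ x∈p∪q⁻ (p ─ q) q))

p⊆q∧∣q∣≤∣p∣⇒q⊆p : ∀ {p q : Subset n} → p ⊆ q → ∣ q ∣ ≤ ∣ p ∣ → q ⊆ p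
p⊆q∧∣q∣≤∣p∣⇒q⊆p {p = p} p⊆q ∣q∣≤∣p∣ {x} x∈q with x ∈? p
... | yes x∈p = x∈p
... | no  x∉p = contradiction (p⊂q⇒∣p∣<∣q∣ (p⊆q , x , x∈q , x∉p)) (ℕₚ.≤⇒≯ ∣q∣≤∣p∣)

Empty⇒∣p∣≡0 : ∀ {p : Subset n} → Empty p → ∣ p ∣ ≡ 0
Empty⇒∣p∣≡0 {n} p-empty = trans (cong ∣_∣ (Empty-unique p-empty)) (∣⊥∣≡0 n)

module _ {ℓ} {P : Pred (Fin n) ℓ} (P? : Decidable P) where

  comprehension : Subset n
  comprehension = tabulate (does ∘ P?)

  ∈-comprehension⁺ : ∀ {x} → P x → x ∈ comprehension
  ∈-comprehension⁺ {x} px = lookup⇒[]= x _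
    (trans (lookup∘tabulate (does ∘ P?) x) (dec-true (P? x) px))

  ∈-comprehension⁻ : ∀ {x} → x ∈ comprehension → P x
  ∈-comprehension⁻ {x} x∈ with P? x | trans (sym (lookup∘tabulate (does ∘ P?) x)) ([]=⇒lookup x∈)
  ... | yes px | _ = px

-- `K` is a partial function whose values on `p` exhaust `q`. Deleting `y` and its partner `x`
-- preserves this, because `x` has no second value. A relation fits both images of maps and inverses
-- of injections.
∣q∣≤∣p∣-by-relation : ∀ (K : Fin n → Fin n → Set) (p q : Subset n) →
  (∀ {x y y'} → K x y → K x y' → y ≡ y') →
  (∀ {y} → y ∈ q → ∃ λ x → x ∈ p × K x y) → ∣ q ∣ ≤ ∣ p ∣
∣q∣≤∣p∣-by-relation {n} K p q functional = go p q (<-wellFounded ∣ p ∣)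
  where
  go : ∀ p q → Acc _<_ ∣ p ∣ → (∀ {y} → y ∈ q → ∃ λ x → x ∈ p × K x y) → ∣ q ∣ ≤ ∣ p ∣
  go p q (acc rec) covered with nonempty? q
  ... | no  q-empty = ℕₚ.≤-trans (ℕₚ.≤-reflexive (Empty⇒∣p∣≡0 q-empty)) z≤n
  ... | yes (y , y∈q) with covered y∈q
  ...   | x , x∈p , Kxy = begin
    ∣ q ∣         ≤⟨ ∣p∣≤1+∣p-x∣ q y ⟩
    suc ∣ q - y ∣ ≤⟨ s≤s (go (p - x) (q - y) (rec (x∈p⇒∣p-x∣<∣p∣ x∈p)) covered′) ⟩
    suc ∣ p - x ∣ ≤⟨ x∈p⇒∣p-x∣<∣p∣ x∈p ⟩
    ∣ p ∣         ∎
    where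
    open ≤-Reasoning
    covered′ : ∀ {y'} → y' ∈ q - y → ∃ λ x' → x' ∈ p - x × K x' y'
    covered′ {y'} y'∈ with covered (p─q⊆p q ⁅ y ⁆ y'∈)
    ... | x' , x'∈p , Kx'y' = x' , x∈p∧x≢y⇒x∈p-y x'∈p x'≢x , Kx'y'
      where
      x'≢x : x' ≢ x
      x'≢x refl = x∈p-y⇒x≢y q y y'∈ (functional Kx'y' Kxy)

InjectiveOn : Subset n → (Fin n → Fin n) → Set
InjectiveOn p g = ∀ {x y} → x ∈ p → y ∈ p → g x ≡ g y → x ≡ y

-- If `y` were missed, `g` would inject `p` into `q - y`, which has fewer elements than `p`.
injective⇒surjective : ∀ {p q : Subset n} (g : Fin n → Fin n) →
  (∀ {x} → x ∈ p → g x ∈ q) → InjectiveOn p g → ∣ q ∣ ≤ ∣ p ∣ →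
  ∀ y → y ∈ q → ∃ λ x → x ∈ p × g x ≡ y
injective⇒surjective {p = p} {q} g g∈q g-inj ∣q∣≤∣p∣ y y∈q
  with any? (λ x → x ∈? p ×-dec g x ≟ y)
... | yes hit = hit
... | no miss = contradiction (ℕₚ.≤-<-trans ∣p∣≤∣q-y∣ (x∈p⇒∣p-x∣<∣p∣ y∈q)) (ℕₚ.≤⇒≯ ∣q∣≤∣p∣)
  where
  ∣p∣≤∣q-y∣ : ∣ p ∣ ≤ ∣ q - y ∣
  ∣p∣≤∣q-y∣ = ∣q∣≤∣p∣-by-relation (λ z x → x ∈ p × g x ≡ z) (q - y) p
    (λ (x∈p , gx≡z) (x'∈p , gx'≡z) → g-inj x∈p x'∈p (trans gx≡z (sym gx'≡z)))
    (λ {x} x∈p → g x , x∈p∧x≢y⇒x∈p-y (g∈q x∈p) (λ gx≡y → miss (x , x∈p , gx≡y)) , x∈p , refl)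

-- Double negation commutes with quantification over the finite type `Fin n`. Hence a stable goal
-- may be proved as if `P` were decidable, although `Adj` is an arbitrary relation.
¬¬-decidable : (P : Fin n → Set) → ¬ ¬ (∀ x → Dec (P x))
¬¬-decidable P = sequence (RawMonad.rawApplicative ¬¬-Monad) (λ _ → ¬¬-excluded-middle)

-- Hall's marriage theorem

module Hall {R : Fin n → Fin n → Set} (R? : ∀ x y → Dec (R x y)) where

  private
    adjacent? : ∀ Q y → Dec (∃ λ x → x ∈ Q × R x y)
    adjacent? Q y = any? (λ x → x ∈? Q ×-dec R? x y)

  -- Neighbours are collected from the whole vertex set, so `N` stays the same while the induction
  -- shrinks `B`.
  N : Subset n → Subset n
  N Q = comprehension (adjacent? Q)

  ∈-N⁺ : ∀ {Q x y} → x ∈ Q → R x y → y ∈ N Q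
  ∈-N⁺ {Q} x∈Q Rxy = ∈-comprehension⁺ (adjacent? Q) (_ , x∈Q , Rxy)

  ∈-N⁻ : ∀ {Q y} → y ∈ N Q → ∃ λ x → x ∈ Q × R x y
  ∈-N⁻ {Q} = ∈-comprehension⁻ (adjacent? Q)

  N-mono : ∀ {Q Q'} → Q ⊆ Q' → N Q ⊆ N Q'
  N-mono Q⊆Q' y∈ with ∈-N⁻ y∈
  ... | x , x∈Q , Rxy = ∈-N⁺ (Q⊆Q' x∈Q) Rxy

  HallCondition : Subset n → Subset n → Set
  HallCondition A B = ∀ Q → Q ⊆ A → ∣ Q ∣ ≤ ∣ N Q ∩ B ∣

  Matching : Subset n → Subset n → Set
  Matching A B = Σ (Fin n → Fin n) λ g →
    (∀ {x} → x ∈ A → g x ∈ B × R x (g x)) × InjectiveOn A g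

  private
    -- A nonempty proper subset without surplus. Properness makes `Q`, and nonemptiness makes
    -- `A ─ Q`, smaller than `A`.
    Tight : Subset n → Subset n → Subset n → Set
    Tight A B Q = Q ⊆ A × (∃ λ x → x ∈ Q) × (∃ λ x → x ∈ A × x ∉ Q) × ∣ N Q ∩ B ∣ ≤ ∣ Q ∣

    tight? : ∀ A B Q → Dec (Tight A B Q)
    tight? A B Q = Q ⊆? A ×-dec nonempty? Q ×-dec
      any? (λ x → x ∈? A ×-dec ¬? (x ∈? Q)) ×-dec ∣ N Q ∩ B ∣ ℕₚ.≤? ∣ Q ∣

  condition-on-tight : ∀ {A B} Q → Q ⊆ A → HallCondition A B → HallCondition Q (N Q ∩ B)
  condition-on-tight {B = B} Q Q⊆A hall Q' Q'⊆Q = ℕₚ.≤-trans (hall Q' (Q⊆A ∘ Q'⊆Q))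
    (p⊆q⇒∣p∣≤∣q∣ λ x∈ → let x∈N , x∈B = x∈p∩q⁻ (N Q') B x∈ in
      x∈p∩q⁺ (x∈N , x∈p∩q⁺ (N-mono Q'⊆Q x∈N , x∈B)))

  -- Apply Hall's condition to `Q' ∪ Q`: at most `∣ Q ∣` of its neighbours lie in `N Q`, so at least
  -- `∣ Q' ∣` lie outside.
  condition-off-tight : ∀ {A B} Q → Q ⊆ A → ∣ N Q ∩ B ∣ ≤ ∣ Q ∣ →
    HallCondition A B → HallCondition (A ─ Q) (B ─ N Q)
  condition-off-tight {A} {B} Q Q⊆A tight hall Q' Q'⊆A─Q =
    ℕₚ.+-cancelʳ-≤ (∣ Q ∣) _ _ (begin
      ∣ Q' ∣ + ∣ Q ∣
        ≤⟨ disjoint⇒∣p∣+∣q∣≤∣p∪q∣ Q' Q (x∈p─q⇒x∉q A Q ∘ Q'⊆A─Q) ⟩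
      ∣ Q' ∪ Q ∣
        ≤⟨ hall (Q' ∪ Q) ([ p─q⊆p A Q ∘ Q'⊆A─Q , Q⊆A ] ∘ x∈p∪q⁻ Q' Q) ⟩
      ∣ N (Q' ∪ Q) ∩ B ∣
        ≤⟨ p⊆q∪r⇒∣p∣≤∣q∣+∣r∣ (N Q' ∩ (B ─ N Q)) (N Q ∩ B) split ⟩
      ∣ N Q' ∩ (B ─ N Q) ∣ + ∣ N Q ∩ B ∣
        ≤⟨ ℕₚ.+-monoʳ-≤ (∣ N Q' ∩ (B ─ N Q) ∣) tight ⟩
      ∣ N Q' ∩ (B ─ N Q) ∣ + ∣ Q ∣ ∎)
    where
    open ≤-Reasoning
    split : N (Q' ∪ Q) ∩ B ⊆ (N Q' ∩ (B ─ N Q)) ∪ (N Q ∩ B)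
    split {y} y∈ with x∈p∩q⁻ (N (Q' ∪ Q)) B y∈
    ... | y∈N , y∈B with y ∈? N Q
    ...   | yes y∈NQ = x∈p∪q⁺ (inj₂ (x∈p∩q⁺ (y∈NQ , y∈B)))
    ...   | no  y∉NQ with ∈-N⁻ y∈N
    ...     | x , x∈ , Rxy with x∈p∪q⁻ Q' Q x∈
    ...       | inj₁ x∈Q' = x∈p∪q⁺ (inj₁ (x∈p∩q⁺ (∈-N⁺ x∈Q' Rxy , x∈p∧x∉q⇒x∈p─q y∈B y∉NQ)))
    ...       | inj₂ x∈Q  = contradiction (∈-N⁺ x∈Q Rxy) y∉NQ

  -- The two matchings cannot collide, since one takes values in `N Q` and the other avoids it.
  combine : ∀ {A B} Q → Matching Q (N Q ∩ B) → Matching (A ─ Q) (B ─ N Q) → Matching A B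
  combine {A} {B} Q (g , g-ok , g-inj) (h , h-ok , h-inj) = k , k-ok , k-inj
    where
    k : Fin n → Fin n
    k x with x ∈? Q
    ... | yes _ = g x
    ... | no  _ = h x
    g∈N : ∀ {x} → x ∈ Q → g x ∈ N Q
    g∈N x∈Q = p∩q⊆p (N Q) B (proj₁ (g-ok x∈Q))
    h∉N : ∀ {x} → x ∈ A ─ Q → h x ∉ N Q
    h∉N x∈ = x∈p─q⇒x∉q B (N Q) (proj₁ (h-ok x∈))
    k-ok : ∀ {x} → x ∈ A → k x ∈ B × R x (k x)
    k-ok {x} x∈A with x ∈? Q
    ... | yes x∈Q = p∩q⊆q (N Q) B (proj₁ (g-ok x∈Q)) , proj₂ (g-ok x∈Q)
    ... | no  x∉Q = p─q⊆p B (N Q) (proj₁ (h-ok x∈)) , proj₂ (h-ok x∈)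
      where x∈ = x∈p∧x∉q⇒x∈p─q x∈A x∉Q
    k-inj : InjectiveOn A k
    k-inj {x} {y} x∈A y∈A eq with x ∈? Q | y ∈? Q
    ... | yes x∈Q | yes y∈Q = g-inj x∈Q y∈Q eq
    ... | yes x∈Q | no  y∉Q =
      contradiction (subst (_∈ N Q) eq (g∈N x∈Q)) (h∉N (x∈p∧x∉q⇒x∈p─q y∈A y∉Q))
    ... | no  x∉Q | yes y∈Q =
      contradiction (subst (_∈ N Q) (sym eq) (g∈N y∈Q)) (h∉N (x∈p∧x∉q⇒x∈p─q x∈A x∉Q))
    ... | no  x∉Q | no  y∉Q = h-inj (x∈p∧x∉q⇒x∈p─q x∈A x∉Q) (x∈p∧x∉q⇒x∈p─q y∈A y∉Q) eq

  -- A nonempty `Q` inside `A - a` misses `a`, so it is proper in `A`. As it is not tight, it has a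
  -- spare neighbour and can afford to lose `b`.
  condition-remove : ∀ {A B} a b → a ∈ A → (∀ Q → ¬ Tight A B Q) → HallCondition (A - a) (B - b)
  condition-remove {A} {B} a b a∈A none Q Q⊆ with nonempty? Q
  ... | no  Q-empty = ℕₚ.≤-trans (ℕₚ.≤-reflexive (Empty⇒∣p∣≡0 Q-empty)) z≤n
  ... | yes x∈Q with ∣ N Q ∩ B ∣ ℕₚ.≤? ∣ Q ∣
  ...   | yes tight = ⊥-elim (none Q
    (p─q⊆p A ⁅ a ⁆ ∘ Q⊆ , x∈Q , (a , a∈A , λ a∈Q → x∈p-y⇒x≢y A a (Q⊆ a∈Q) refl) , tight))
  ...   | no  loose = s≤s⁻¹ (ℕₚ.≤-trans (ℕₚ.≰⇒> loose)
                        (p⊆q∪⁅x⁆⇒∣p∣≤1+∣q∣ (N Q ∩ (B - b)) b split))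
    where
    split : N Q ∩ B ⊆ (N Q ∩ (B - b)) ∪ ⁅ b ⁆
    split y∈ with x∈p∩q⁻ (N Q) B y∈
    ... | y∈N , y∈B with x∈p∪q⁻ (B - b) ⁅ b ⁆ (p⊆p-x∪⁅x⁆ B b y∈B)
    ...   | inj₁ y∈B-b = x∈p∪q⁺ (inj₁ (x∈p∩q⁺ (y∈N , y∈B-b)))
    ...   | inj₂ y∈⁅b⁆ = x∈p∪q⁺ (inj₂ y∈⁅b⁆)

  extend : ∀ {A B} a b → b ∈ B → R a b → Matching (A - a) (B - b) → Matching A B
  extend {A} {B} a b b∈B Rab (g , g-ok , g-inj) = k , k-ok , k-inj
    where
    k : Fin n → Fin n
    k x with x ≟ a
    ... | yes _ = b
    ... | no  _ = g x
    k-ok : ∀ {x} → x ∈ A → k x ∈ B × R x (k x)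
    k-ok {x} x∈A with x ≟ a
    ... | yes refl = b∈B , Rab
    ... | no  x≢a  = p─q⊆p B ⁅ b ⁆ (proj₁ (g-ok x∈)) , proj₂ (g-ok x∈)
      where x∈ = x∈p∧x≢y⇒x∈p-y x∈A x≢a
    g≢b : ∀ {x} → x ∈ A → x ≢ a → g x ≢ b
    g≢b x∈A x≢a = x∈p-y⇒x≢y B b (proj₁ (g-ok (x∈p∧x≢y⇒x∈p-y x∈A x≢a)))
    k-inj : InjectiveOn A k
    k-inj {x} {y} x∈A y∈A eq with x ≟ a | y ≟ a
    ... | yes refl | yes refl = refl
    ... | yes _    | no y≢a   = contradiction (sym eq) (g≢b y∈A y≢a)
    ... | no x≢a   | yes _    = contradiction eq (g≢b x∈A x≢a)
    ... | no x≢a   | no y≢a   = g-inj (x∈p∧x≢y⇒x∈p-y x∈A x≢a) (x∈p∧x≢y⇒x∈p-y y∈A y≢a) eq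

  -- Records the prescribed pair, which later becomes the guard crossing the attacked edge.
  extend-at : ∀ {A B} a b (b∈B : b ∈ B) (Rab : R a b) (m : Matching (A - a) (B - b)) →
    proj₁ (extend a b b∈B Rab m) a ≡ b
  extend-at a b b∈B Rab m with a ≟ a
  ... | yes _  = refl
  ... | no a≢a = contradiction refl a≢a

  -- The Halmos-Vaughan induction: a tight set splits the problem into two smaller ones, and without
  -- tight sets any admissible pair `a`, `b` can be matched first.
  hall : ∀ A B → HallCondition A B → Matching A B
  hall A B = go A B (<-wellFounded ∣ A ∣)
    where
    go : ∀ A B → Acc _<_ ∣ A ∣ → HallCondition A B → Matching A B
    go A B (acc rec) cond with nonempty? A
    ... | no A-empty = id , (λ x∈A → contradiction (_ , x∈A) A-empty)
                          , (λ x∈A → contradiction (_ , x∈A) A-empty)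
    ... | yes (a , a∈A) with anySubset? (tight? A B)
    ...   | yes (Q , Q⊆A , (q , q∈Q) , (x , x∈A , x∉Q) , tight) = combine Q
      (go Q (N Q ∩ B) (rec (p⊂q⇒∣p∣<∣q∣ (Q⊆A , x , x∈A , x∉Q))) (condition-on-tight Q Q⊆A cond))
      (go (A ─ Q) (B ─ N Q) (rec (p∩q≢∅⇒∣p─q∣<∣p∣ A Q (q , x∈p∩q⁺ (Q⊆A q∈Q , q∈Q))))
        (condition-off-tight Q Q⊆A tight cond))
    ...   | no none with nonempty? (N ⁅ a ⁆ ∩ B)
    ...     | no N-empty = contradiction (ℕₚ.≤-trans (ℕₚ.≤-reflexive (sym (∣⁅x⁆∣≡1 a)))
      (ℕₚ.≤-trans (cond ⁅ a ⁆ (λ x∈ → subst (_∈ A) (sym (x∈⁅y⁆⇒x≡y a x∈)) a∈A))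
      (ℕₚ.≤-reflexive (Empty⇒∣p∣≡0 N-empty)))) (λ ())
    ...     | yes (b , b∈) with x∈p∩q⁻ (N ⁅ a ⁆) B b∈
    ...       | b∈N , b∈B with ∈-N⁻ b∈N
    ...         | a' , a'∈ , Rab = extend a b b∈B (subst (λ z → R z b) (x∈⁅y⁆⇒x≡y a a'∈) Rab)
      (go (A - a) (B - b) (rec (x∈p⇒∣p-x∣<∣p∣ a∈A))
        (condition-remove a b a∈A (λ Q t → none (Q , t))))

module _ (G : Graph n) where
  open Graph G renaming (sym to Adj-sym)

  -- Reachability and cut vertices

  Reach-mono : ∀ {S T} → S ⊆ T → ∀ {x y} → Reach G S x y → Reach G T x y
  Reach-mono S⊆T (here x∈S)      = here (S⊆T x∈S)
  Reach-mono S⊆T (step r a z∈S) = step (Reach-mono S⊆T r) a (S⊆T z∈S)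

  Reach-trans : ∀ {S x y z} → Reach G S x y → Reach G S y z → Reach G S x z
  Reach-trans r (here _)      = r
  Reach-trans r (step s a z∈) = step (Reach-trans r s) a z∈

  Reach-target : ∀ {S x y} → Reach G S x y → y ∈ S
  Reach-target (here x∈S)     = x∈S
  Reach-target (step _ _ z∈S) = z∈S

  Reach-sym : ∀ {S x y} → Reach G S x y → Reach G S y x
  Reach-sym (here x∈S)     = here x∈S
  Reach-sym (step r a z∈S) =
    Reach-trans (step (here z∈S) (Adj-sym a) (Reach-target r)) (Reach-sym r)

  ClosedIn : Subset n → Subset n → Set
  ClosedIn S P = ∀ {y z} → y ∈ P → Adj y z → z ∈ S → z ∈ P

  Reach-closed : ∀ {S P x y} → ClosedIn S P → x ∈ P → Reach G S x y → y ∈ P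
  Reach-closed closed x∈P (here _)       = x∈P
  Reach-closed closed x∈P (step r a z∈S) = closed (Reach-closed closed x∈P r) a z∈S

  crossing : ∀ {S x y} P → x ∈ P → y ∉ P → Reach G S x y →
    ∃ λ u → ∃ λ w → u ∈ P × w ∉ P × Adj u w × w ∈ S
  crossing P x∈P y∉P (here _) = contradiction x∈P y∉P
  crossing P x∈P z∉P (step {y} r a z∈S) with y ∈? P
  ... | yes y∈P = _ , _ , y∈P , z∉P , a , z∈S
  ... | no  y∉P = crossing P x∈P y∉P r

  neighbour : Connected G → ∀ {x y} → x ≢ y → ∃ λ z → Adj z x
  neighbour conn {x} {y} x≢y
    with crossing ⁅ x ⁆ (x∈⁅x⁆ x) (x≢y ∘ sym ∘ x∈⁅y⁆⇒x≡y x) (conn x y ∈⊤ ∈⊤)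
  ... | u , w , u∈ , _ , a , _ rewrite x∈⁅y⁆⇒x≡y x u∈ = w , Adj-sym a

  -- Any two vertices other than `w` lie in `A` and are joined through `r` by a walk inside `A`,
  -- which avoids `w`.
  spanned-complement⇒¬CutVertex : ∀ A r w → (∀ y → y ∈ A → Reach G A r y) → w ∉ A →
    (∀ y → y ≢ w → y ∈ A) → ¬ CutVertex G w
  spanned-complement⇒¬CutVertex A r w spanned w∉A full (a , b , a≢w , b≢w , _ , unreachable) =
    unreachable (Reach-mono A⊆ (Reach-trans
      (Reach-sym (spanned a (full a a≢w))) (spanned b (full b b≢w))))
    where
    A⊆ : A ⊆ ⊤ - w
    A⊆ y∈A = x∈p∧x≢y⇒x∈p-y ∈⊤ (λ { refl → w∉A y∈A })

  -- Grow a connected vertex set one vertex at a time: the vertex added last is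
  -- not a cut vertex.
  non-cut-vertex : Connected G → ∀ {r z : Fin n} → r ≢ z → ∃ λ v → ¬ CutVertex G v
  non-cut-vertex conn {r} {z} r≢z =
    grow ⁅ r ⁆ (<-wellFounded _) (x∈⁅x⁆ r)
      (λ y y∈ → subst (Reach G ⁅ r ⁆ r) (sym (x∈⁅y⁆⇒x≡y r y∈)) (here (x∈⁅x⁆ r)))
      (r≢z ∘ sym ∘ x∈⁅y⁆⇒x≡y r)
    where
    grow : ∀ A → Acc _<_ ∣ ∁ A ∣ → r ∈ A → (∀ y → y ∈ A → Reach G A r y) →
           ∀ {z} → z ∉ A → ∃ λ v → ¬ CutVertex G v
    grow A (acc rec) r∈A spanned {z} z∉A with crossing A r∈A z∉A (conn r z ∈⊤ ∈⊤)
    -- Either `w` is the only vertex outside `A`, or another vertex `y` stays outside after `w` is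
    -- added and growth continues.
    ... | u , w , u∈A , w∉A , a , _ with any? (λ y → ¬? (y ≟ w) ×-dec ¬? (y ∈? A))
    ...   | no full = w , spanned-complement⇒¬CutVertex A r w spanned w∉A
      (λ y y≢w → decidable-stable (y ∈? A) (λ y∉A → full (y , y≢w , y∉A)))
    ...   | yes (y , y≢w , y∉A) = grow A⁺ (rec smaller) (A⊆A⁺ r∈A) spanned⁺ y∉A⁺
      where
      A⁺ = A ∪ ⁅ w ⁆
      A⊆A⁺ : A ⊆ A⁺
      A⊆A⁺ = p⊆p∪q ⁅ w ⁆
      w∈A⁺ : w ∈ A⁺
      w∈A⁺ = x∈p∪q⁺ (inj₂ (x∈⁅x⁆ w))
      smaller : ∣ ∁ A⁺ ∣ < ∣ ∁ A ∣
      smaller = p⊂q⇒∣p∣<∣q∣ (p⊂q⇒∁p⊃∁q (A⊆A⁺ , w , w∈A⁺ , w∉A))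
      spanned⁺ : ∀ y → y ∈ A⁺ → Reach G A⁺ r y
      spanned⁺ y y∈ with x∈p∪q⁻ A ⁅ w ⁆ y∈
      ... | inj₁ y∈A = Reach-mono A⊆A⁺ (spanned y y∈A)
      ... | inj₂ y∈w rewrite x∈⁅y⁆⇒x≡y w y∈w = step (Reach-mono A⊆A⁺ (spanned u u∈A)) a w∈A⁺
      y∉A⁺ : y ∉ A⁺
      y∉A⁺ = [ y∉A , y≢w ∘ x∈⁅y⁆⇒x≡y w ] ∘ x∈p∪q⁻ A ⁅ w ⁆

  -- Eternal classes of minimum covers contain all cut vertices

  -- The vertex `x` is empty, so the attack forces the guard on `u` out of `P`. No guard enters `P`,
  -- because edges into `P` from outside start at `x`.
  lose-guard : ∀ {C} → EVCClass G C → ∀ S → C S → ∀ {x u} P → x ∉ S → x ∉ P → u ∈ P → Adj u x →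
    (∀ {y z} → y ∈ P → Adj y z → z ≢ x → z ∈ P) →
    ∃ λ S' → C S' × ∣ S' ∩ P ∣ < ∣ S ∩ P ∣
  lose-guard (_ , _ , defend) S CS {x} {u} P x∉S x∉P u∈P u~x P-closed with defend S CS u x u~x
  ... | S' , _ , _ , _ , _ , _ , _ , inj₂ (x∈S , _) = contradiction x∈S x∉S
  ... | S' , CS' , f , f-step , _ , f-surj , _ , inj₁ (u∈S , fu≡x) = S' , CS' ,
    ℕₚ.≤-<-trans
      (∣q∣≤∣p∣-by-relation (λ z y → f z ≡ y) (S ∩ P - u) (S' ∩ P)
        (λ fz≡y fz≡y' → trans (sym fz≡y) fz≡y') origin)
      (x∈p⇒∣p-x∣<∣p∣ (x∈p∩q⁺ (u∈S , u∈P)))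
    where
    stays : ∀ {z y} → z ∈ S → f z ≡ y → y ∈ P → z ∈ P
    stays {z} z∈S refl fz∈P with f-step z z∈S
    ... | inj₁ fz≡z = subst (_∈ P) fz≡z fz∈P
    ... | inj₂ z~fz = P-closed fz∈P (Adj-sym z~fz) (λ { refl → x∉S z∈S })
    origin : ∀ {y} → y ∈ S' ∩ P → ∃ λ z → z ∈ S ∩ P - u × f z ≡ y
    origin {y} y∈ with x∈p∩q⁻ S' P y∈
    ... | y∈S' , y∈P with f-surj y y∈S'
    ...   | z , z∈S , fz≡y = z ,
      x∈p∧x≢y⇒x∈p-y (x∈p∩q⁺ (z∈S , stays z∈S fz≡y y∈P))
        (λ { refl → x∉P (subst (_∈ P) (trans (sym fz≡y) fu≡x) y∈P) }) ,
      fz≡y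

  cutVertex∈config : ∀ {C} → EVCClass G C → (∀ S → C S → MinVC G S) →
    ∀ S → C S → ∀ x → CutVertex G x → x ∈ S
  cutVertex∈config {C} evc minimum S CS x (a , b , a≢x , b≢x , a⇝b , unreachable) =
    decidable-stable (x ∈? S) λ x∉S → ¬¬-decidable (Reach G (⊤ - x) a) (absurd x∉S)
    where
    absurd : x ∉ S → ¬ (∀ y → Dec (Reach G (⊤ - x) a y))
    absurd x∉S A? = ℕₚ.<⇒≱ ∣T∣<∣S∣ (proj₂ (minimum S CS) T T-cover)
      where
      -- `P` is the component of `a` in the graph without `x`. `Q` is the rest of that graph and
      -- contains `b`.
      P = comprehension A?
      Q = ∁ P - x

      P-closed : ∀ {y z} → y ∈ P → Adj y z → z ≢ x → z ∈ P
      P-closed y∈P y~z z≢x = ∈-comprehension⁺ A?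
        (step (∈-comprehension⁻ A? y∈P) y~z (x∈p∧x≢y⇒x∈p-y ∈⊤ z≢x))
      x∉P : x ∉ P
      x∉P x∈P = x∈p-y⇒x≢y ⊤ x (Reach-target (∈-comprehension⁻ A? x∈P)) refl
      a∈P : a ∈ P
      a∈P = ∈-comprehension⁺ A? (here (x∈p∧x≢y⇒x∈p-y ∈⊤ a≢x))
      b∉P : b ∉ P
      b∉P = unreachable ∘ ∈-comprehension⁻ A?

      ∈Q⁺ : ∀ {z} → z ∉ P → z ≢ x → z ∈ Q
      ∈Q⁺ z∉P z≢x = x∈p∧x≢y⇒x∈p-y (x∉p⇒x∈∁p z∉P) z≢x
      Q⇒∉P : ∀ {z} → z ∈ Q → z ∉ P
      Q⇒∉P z∈Q = x∈∁p⇒x∉p (p─q⊆p (∁ P) ⁅ x ⁆ z∈Q)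
      x∉Q : x ∉ Q
      x∉Q x∈Q = x∈p-y⇒x≢y (∁ P) x x∈Q refl
      Q-closed : ∀ {y z} → y ∈ Q → Adj y z → z ≢ x → z ∈ Q
      Q-closed y∈Q y~z z≢x = ∈Q⁺
        (λ z∈P → Q⇒∉P y∈Q (P-closed z∈P (Adj-sym y~z) (x∈p-y⇒x≢y (∁ P) x y∈Q))) z≢x

      LighterOn : Subset n → Set
      LighterOn P = ∃ λ S' → C S' × ∣ S' ∩ P ∣ < ∣ S ∩ P ∣

      lighter : ∀ P {c d} → x ∉ P → (∀ {y z} → y ∈ P → Adj y z → z ≢ x → z ∈ P) →
        c ∈ P → d ∉ P → Reach G ⊤ c d → LighterOn P
      lighter P x∉P P-closed c∈P d∉P c⇝d with crossing P c∈P d∉P c⇝d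
      -- By `P-closed`, an edge leaving `P` can only end at `x`, so `u` is a neighbour of `x` in
      -- `P`.
      ... | u , w , u∈P , w∉P , u~w , _ = lose-guard evc S CS P x∉S x∉P u∈P
        (subst (Adj u) (decidable-stable (w ≟ x) (w∉P ∘ P-closed u∈P u~w)) u~w) P-closed

      lighter₁ : LighterOn P
      lighter₁ = lighter P x∉P P-closed a∈P b∉P a⇝b
      lighter₂ : LighterOn Q
      lighter₂ = lighter Q x∉Q Q-closed (∈Q⁺ b∉P b≢x) (λ a∈Q → Q⇒∉P a∈Q a∈P) (Reach-sym a⇝b)

      S₁ = proj₁ lighter₁
      S₂ = proj₁ lighter₂
      T₀ = (S₁ ∩ P) ∪ (S₂ ∩ Q)
      T = T₀ ∪ ⁅ x ⁆

      in₁ : ∀ {z} → z ∈ P → z ∈ S₁ → z ∈ T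
      in₁ z∈P z∈S₁ = x∈p∪q⁺ (inj₁ (x∈p∪q⁺ (inj₁ (x∈p∩q⁺ (z∈S₁ , z∈P)))))
      in₂ : ∀ {z} → z ∈ Q → z ∈ S₂ → z ∈ T
      in₂ z∈Q z∈S₂ = x∈p∪q⁺ (inj₁ (x∈p∪q⁺ (inj₂ (x∈p∩q⁺ (z∈S₂ , z∈Q)))))
      in₀ : ∀ {z} → z ≡ x → z ∈ T
      in₀ z≡x = x∈p∪q⁺ (inj₂ (subst (_∈ ⁅ x ⁆) (sym z≡x) (x∈⁅x⁆ x)))

      T-cover : VertexCover G T
      T-cover p q p~q with p ≟ x | q ≟ x | p ∈? P
      ... | yes p≡x | _ | _ = inj₁ (in₀ p≡x)
      ... | no _ | yes q≡x | _ = inj₂ (in₀ q≡x)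
      -- An edge avoiding `x` lies within one side, where `T` agrees with a vertex cover, `S₁` or
      -- `S₂`.
      ... | no p≢x | no q≢x | yes p∈P =
          [ inj₁ ∘ in₁ p∈P , inj₂ ∘ in₁ (P-closed p∈P p~q q≢x) ]
            (proj₁ (minimum S₁ (proj₁ (proj₂ lighter₁))) p q p~q)
      ... | no p≢x | no q≢x | no p∉P =
          [ inj₁ ∘ in₂ (∈Q⁺ p∉P p≢x) , inj₂ ∘ in₂ (Q-closed (∈Q⁺ p∉P p≢x) p~q q≢x) ]
            (proj₁ (minimum S₂ (proj₁ (proj₂ lighter₂))) p q p~q)

      open ≤-Reasoning
      ∣T∣<∣S∣ : ∣ T ∣ < ∣ S ∣
      ∣T∣<∣S∣ = begin-strict
        ∣ T ∣                       ≤⟨ p⊆q∪⁅x⁆⇒∣p∣≤1+∣q∣ T₀ x id ⟩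
        suc ∣ T₀ ∣                  ≤⟨ s≤s (∣p∪q∣≤∣p∣+∣q∣ (S₁ ∩ P) (S₂ ∩ Q)) ⟩
        -- The guard saved on `P` pays for `x`; the one saved on `Q` makes the inequality strict.
        suc ∣ S₁ ∩ P ∣ + ∣ S₂ ∩ Q ∣ <⟨ ℕₚ.+-mono-≤-< (proj₂ (proj₂ lighter₁)) (proj₂ (proj₂ lighter₂)) ⟩
        ∣ S ∩ P ∣ + ∣ S ∩ Q ∣       ≤⟨ disjoint⇒∣p∣+∣q∣≤∣p∪q∣ (S ∩ P) (S ∩ Q)
                                         (λ z∈P z∈Q → Q⇒∉P (p∩q⊆q S Q z∈Q) (p∩q⊆q S P z∈P)) ⟩
        ∣ (S ∩ P) ∪ (S ∩ Q) ∣       ≤⟨ p⊆q⇒∣p∣≤∣q∣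
                                         ([ p∩q⊆p S P , p∩q⊆p S Q ] ∘ x∈p∪q⁻ (S ∩ P) (S ∩ Q)) ⟩
        ∣ S ∣                       ∎

  -- Defending with minimum covers that contain all cut vertices

  MinVC∋Cuts : Subset n → Set
  MinVC∋Cuts S = MinVC G S × (∀ x → CutVertex G x → x ∈ S)

  Move-swap : ∀ {S S' u v} → Move G S S' u v → Move G S S' v u
  Move-swap (f , f-step , f-inj , f-surj , f∈ , inj₁ m) = f , f-step , f-inj , f-surj , f∈ , inj₂ m
  Move-swap (f , f-step , f-inj , f-surj , f∈ , inj₂ m) = f , f-step , f-inj , f-surj , f∈ , inj₁ m

  module _ (Adj? : ∀ x y → Dec (Adj x y)) where

    Step : Fin n → Fin n → Set
    Step x y = x ≡ y ⊎ Adj x y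

    Step? : ∀ x y → Dec (Step x y)
    Step? x y = x ≟ y ⊎-dec Adj? x y

    open Hall Step?

    -- The matching runs backwards, from each target vertex to the origin of its guard. By
    -- cardinality it is onto `S`, and its inverse is the move. This direction places Hall violators
    -- in `S'`, where they can be exchanged.
    matching⇒move : ∀ {S S' u v} → ∣ S ∣ ≤ ∣ S' ∣ → u ∈ S → v ∈ S' →
      (m : Matching S' S) → proj₁ m v ≡ u → Move G S S' u v
    matching⇒move {S} {S'} {u} {v} ∣S∣≤∣S'∣ u∈S v∈S' (g , g-ok , g-inj) gv≡u =
      f , f-step , f-inj , f-surj , f∈S' , inj₁ (u∈S , fu≡v)
      where
      preimage = injective⇒surjective g (proj₁ ∘ g-ok) g-inj ∣S∣≤∣S'∣
      f : Fin n → Fin n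
      f x with x ∈? S
      ... | yes x∈S = proj₁ (preimage x x∈S)
      -- A default where no guard stands; `Move` constrains `f` on `S` only.
      ... | no  _   = x
      f-spec : ∀ x → x ∈ S → f x ∈ S' × g (f x) ≡ x
      f-spec x x∈S with x ∈? S
      ... | yes x∈S′ = proj₂ (preimage x x∈S′)
      ... | no  x∉S  = contradiction x∈S x∉S
      f∈S' : ∀ x → x ∈ S → f x ∈ S'
      f∈S' x = proj₁ ∘ f-spec x
      f-of-g : ∀ y → y ∈ S' → f (g y) ≡ y
      f-of-g y y∈S' = let f∈ , gfg≡g = f-spec (g y) (proj₁ (g-ok y∈S')) in g-inj f∈ y∈S' gfg≡g
      f-step : ∀ x → x ∈ S → f x ≡ x ⊎ Adj x (f x)
      f-step x x∈S with f-spec x x∈S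
      ... | fx∈S' , gfx≡x = map₂ Adj-sym (subst (Step (f x)) gfx≡x (proj₂ (g-ok fx∈S')))
      f-inj : ∀ x y → x ∈ S → y ∈ S → f x ≡ f y → x ≡ y
      f-inj x y x∈S y∈S fx≡fy =
        trans (sym (proj₂ (f-spec x x∈S))) (trans (cong g fx≡fy) (proj₂ (f-spec y y∈S)))
      f-surj : ∀ y → y ∈ S' → Σ (Fin n) λ x → x ∈ S × f x ≡ y
      f-surj y y∈S' = g y , proj₁ (g-ok y∈S') , f-of-g y y∈S'
      fu≡v : f u ≡ v
      fu≡v = trans (cong f (sym gv≡u)) (f-of-g v v∈S')

    -- Trading `Q` for its closed neighbourhood `D` in `S` brings in only vertices of `S`. It
    -- discards a vertex of `Q` outside `S`, which exists because `S` is connected.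
    violation⇒closer : ∀ {S S' u v} Q → MinVC∋Cuts S → ConnectedSet G S → MinVC∋Cuts S' →
      u ∈ S → v ∈ S' → Q ⊆ S' - v → ∣ N Q ∩ (S - u) ∣ < ∣ Q ∣ →
      ∃ λ T → MinVC∋Cuts T × v ∈ T × ∣ T ─ S ∣ < ∣ S' ─ S ∣
    violation⇒closer {S} {S'} {u} {v} Q ((S-cover , S-min) , cuts⊆S) S-conn
      ((S'-cover , S'-min) , cuts⊆S') u∈S v∈S' Q⊆ violated =
      T , (T-min , cuts⊆T) , v∈T , p⊂q⇒∣p∣<∣q∣ T─S⊂S'─S
      where
      open ≤-Reasoning
      D = N Q ∩ S
      T = (S' ─ Q) ∪ D

      Q⊆S' : Q ⊆ S'
      Q⊆S' = p─q⊆p S' ⁅ v ⁆ ∘ Q⊆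

      v∉Q : v ∉ Q
      v∉Q v∈Q = x∈p-y⇒x≢y S' v (Q⊆ v∈Q) refl

      Q∩S⊆D : ∀ {x} → x ∈ Q → x ∈ S → x ∈ D
      Q∩S⊆D x∈Q x∈S = x∈p∩q⁺ (∈-N⁺ x∈Q (inj₁ refl) , x∈S)

      N∩S-u : ∀ {x} → x ∈ D → x ≢ u → x ∈ N Q ∩ (S - u)
      N∩S-u x∈D x≢u = let x∈N , x∈S = x∈p∩q⁻ (N Q) S x∈D in
        x∈p∩q⁺ (x∈N , x∈p∧x≢y⇒x∈p-y x∈S x≢u)

      ∣D∣≤∣Q∣ : ∣ D ∣ ≤ ∣ Q ∣
      -- `D` may contain `u`, which the violated condition excludes; the strict inequality absorbs
      -- this one extra vertex.
      ∣D∣≤∣Q∣ = ℕₚ.≤-trans (p⊆q∪⁅x⁆⇒∣p∣≤1+∣q∣ (N Q ∩ (S - u)) u split) violated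
        where
        split : D ⊆ (N Q ∩ (S - u)) ∪ ⁅ u ⁆
        split {x} x∈D with x ≟ u
        ... | yes refl = x∈p∪q⁺ (inj₂ (x∈⁅x⁆ u))
        ... | no x≢u   = x∈p∪q⁺ (inj₁ (N∩S-u x∈D x≢u))

      ∣T∣≤∣S'∣ : ∣ T ∣ ≤ ∣ S' ∣
      ∣T∣≤∣S'∣ = begin
        ∣ T ∣              ≤⟨ ∣p∪q∣≤∣p∣+∣q∣ (S' ─ Q) D ⟩
        ∣ S' ─ Q ∣ + ∣ D ∣ ≤⟨ ℕₚ.+-monoʳ-≤ ∣ S' ─ Q ∣ ∣D∣≤∣Q∣ ⟩
        ∣ S' ─ Q ∣ + ∣ Q ∣ ≤⟨ ∣p─q∣+∣q∣≤∣p∣ Q⊆S' ⟩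
        ∣ S' ∣             ∎

      keep : ∀ {x} → x ∈ S' → x ∉ Q → x ∈ T
      keep x∈S' x∉Q = x∈p∪q⁺ (inj₁ (x∈p∧x∉q⇒x∈p─q x∈S' x∉Q))

      covers : ∀ {p q} → Adj p q → p ∈ S' → p ∈ T ⊎ q ∈ T
      covers {p} {q} p~q p∈S' with p ∈? Q
      ... | no p∉Q  = inj₁ (keep p∈S' p∉Q)
      -- The edge is still covered by `S`. Its end in `S` belongs to `D`, through a loop if it is
      -- `p` and through the edge if it is `q`.
      ... | yes p∈Q with S-cover p q p~q
      ...   | inj₁ p∈S = inj₁ (x∈p∪q⁺ (inj₂ (Q∩S⊆D p∈Q p∈S)))
      ...   | inj₂ q∈S = inj₂ (x∈p∪q⁺ (inj₂ (x∈p∩q⁺ (∈-N⁺ p∈Q (inj₂ p~q) , q∈S))))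

      T-cover : VertexCover G T
      T-cover p q p~q with S'-cover p q p~q
      ... | inj₁ p∈S' = covers p~q p∈S'
      ... | inj₂ q∈S' = [ inj₂ , inj₁ ] (covers (Adj-sym p~q) q∈S')

      T-min : MinVC G T
      T-min = T-cover , λ U U-cover → ℕₚ.≤-trans ∣T∣≤∣S'∣ (S'-min U U-cover)

      cuts⊆T : ∀ x → CutVertex G x → x ∈ T
      cuts⊆T x cut with x ∈? Q
      ... | yes x∈Q = x∈p∪q⁺ (inj₂ (Q∩S⊆D x∈Q (cuts⊆S x cut)))
      ... | no  x∉Q = keep (cuts⊆S' x cut) x∉Q

      v∈T : v ∈ T
      v∈T = keep v∈S' v∉Q

      Q⊈S : ¬ (Q ⊆ S)
      Q⊈S Q⊆S = ℕₚ.<⇒≱ ∣S'-v∣<∣S∣ ∣S∣≤∣S'-v∣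
        where
        Q⊆D : Q ⊆ D
        Q⊆D x∈Q = Q∩S⊆D x∈Q (Q⊆S x∈Q)
        D⊆Q : D ⊆ Q
        D⊆Q = p⊆q∧∣q∣≤∣p∣⇒q⊆p Q⊆D ∣D∣≤∣Q∣
        u∈D : u ∈ D
        -- Otherwise the loops alone place all of `Q` in `N Q ∩ (S - u)`, against the violation.
        u∈D = decidable-stable (u ∈? D) λ u∉D → ℕₚ.<⇒≱ violated
          (p⊆q⇒∣p∣≤∣q∣ λ x∈Q → N∩S-u (Q⊆D x∈Q) (λ { refl → u∉D (Q⊆D x∈Q) }))
        Q-closed : ClosedIn S Q
        Q-closed y∈Q y~z z∈S = D⊆Q (x∈p∩q⁺ (∈-N⁺ y∈Q (inj₂ y~z) , z∈S))
        S⊆Q : S ⊆ Q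
        S⊆Q {s} s∈S = Reach-closed Q-closed (D⊆Q u∈D) (S-conn u s u∈S s∈S)
        ∣S∣≤∣S'-v∣ : ∣ S ∣ ≤ ∣ S' - v ∣
        ∣S∣≤∣S'-v∣ = p⊆q⇒∣p∣≤∣q∣ (Q⊆ ∘ S⊆Q)
        ∣S'-v∣<∣S∣ : ∣ S' - v ∣ < ∣ S ∣
        ∣S'-v∣<∣S∣ = ℕₚ.<-≤-trans (x∈p⇒∣p-x∣<∣p∣ v∈S') (S'-min S S-cover)

      outsider : ∃ λ q → q ∈ Q × q ∉ S
      outsider = decidable-stable (any? (λ q → q ∈? Q ×-dec ¬? (q ∈? S)))
        λ none → Q⊈S (λ {q} q∈Q → decidable-stable (q ∈? S) (λ q∉S → none (q , q∈Q , q∉S)))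

      T─S⊆S'─S : T ─ S ⊆ S' ─ S
      T─S⊆S'─S x∈ with x∈p∪q⁻ (S' ─ Q) D (p─q⊆p T S x∈)
      ... | inj₁ x∈S'─Q = x∈p∧x∉q⇒x∈p─q (p─q⊆p S' Q x∈S'─Q) (x∈p─q⇒x∉q T S x∈)
      ... | inj₂ x∈D    = contradiction (p∩q⊆q (N Q) S x∈D) (x∈p─q⇒x∉q T S x∈)

      T─S⊂S'─S : T ─ S ⊂ S' ─ S
      T─S⊂S'─S = let q , q∈Q , q∉S = outsider in
        T─S⊆S'─S , q , x∈p∧x∉q⇒x∈p─q (Q⊆S' q∈Q) q∉S , λ q∈ →
          [ (λ q∈S'─Q → x∈p─q⇒x∉q S' Q q∈S'─Q q∈Q) , q∉S ∘ p∩q⊆q (N Q) S ]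
            (x∈p∪q⁻ (S' ─ Q) D (p─q⊆p T S q∈))

    -- `S'` is only a first candidate. Each Hall violation replaces it by a target that still
    -- contains `v` and has fewer vertices outside `S`. When none remains, matching `S' - v` into
    -- `S - u` and adding the pair `v`, `u` gives the move.
    defend-towards : ∀ {S u v} → MinVC∋Cuts S → ConnectedSet G S → Adj u v → u ∈ S →
      ∀ S' → MinVC∋Cuts S' → v ∈ S' → Σ (Subset n) λ T → MinVC∋Cuts T × Move G S T u v
    defend-towards {S} {u} {v} CS S-conn u~v u∈S S' = go S' (<-wellFounded _)
      where
      go : ∀ S' → Acc _<_ ∣ S' ─ S ∣ → MinVC∋Cuts S' → v ∈ S' →
        Σ (Subset n) λ T → MinVC∋Cuts T × Move G S T u v
      go S' (acc rec) CS' v∈S'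
        with anySubset? (λ Q → Q ⊆? (S' - v) ×-dec ∣ N Q ∩ (S - u) ∣ ℕₚ.<? ∣ Q ∣)
      ... | yes (Q , Q⊆ , violated) =
        let T , CT , v∈T , closer = violation⇒closer Q CS S-conn CS' u∈S v∈S' Q⊆ violated
        in go T (rec closer) CT v∈T
      ... | no none = S' , CS' ,
        matching⇒move (proj₂ (proj₁ CS) S' (proj₁ (proj₁ CS'))) u∈S v∈S'
          (extend v u u∈S v→u m) (extend-at v u u∈S v→u m)
        where
        v→u : Step v u
        v→u = inj₂ (Adj-sym u~v)
        m : Matching (S' - v) (S - u)
        m = hall (S' - v) (S - u) λ Q Q⊆ → ℕₚ.≮⇒≥ (λ violated → none (Q , Q⊆ , violated))

    -- Membership in the class of the theorem makes every configuration connected, as the exchange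
    -- argument requires; `extendable` supplies the first candidate target.
    MinVC∋Cuts-EVCClass : InF G →
      (∀ v → ¬ CutVertex G v → Σ (Subset n) λ S → MinVC G S × (∀ x → CutVertex G x → x ∈ S) × v ∈ S) →
      EVCClass G MinVC∋Cuts
    MinVC∋Cuts-EVCClass (_ , induces-connected) extendable =
        (λ _ → proj₁ ∘ proj₁)
      , (λ S T ((S-cover , S-min) , _) ((T-cover , T-min) , _) →
           ℕₚ.≤-antisym (S-min T T-cover) (T-min S S-cover))
      , defend
      where
      target : ∀ S → MinVC∋Cuts S → ∀ v → Σ (Subset n) λ S' → MinVC∋Cuts S' × v ∈ S'
      target S CS@(_ , cuts⊆S) v with v ∈? S
      -- With both ends of the attacked edge occupied, the configuration can serve as its own
      -- target.
      ... | yes v∈S = S , CS , v∈S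
      ... | no  v∉S = let S' , S'-min , cuts⊆S' , v∈S' = extendable v (v∉S ∘ cuts⊆S v)
                      in S' , (S'-min , cuts⊆S') , v∈S'

      push : ∀ S → MinVC∋Cuts S → ∀ {u v} → Adj u v → u ∈ S →
        Σ (Subset n) λ T → MinVC∋Cuts T × Move G S T u v
      push S CS@(S-min , cuts⊆S) {v = v} u~v u∈S = let S' , CS' , v∈S' = target S CS v in
        defend-towards CS (induces-connected S S-min cuts⊆S) u~v u∈S S' CS' v∈S'

      defend : ∀ S → MinVC∋Cuts S → ∀ u v → Adj u v →
        Σ (Subset n) λ T → MinVC∋Cuts T × Move G S T u v
      defend S CS u v u~v with proj₁ (proj₁ CS) u v u~v
      ... | inj₁ u∈S = push S CS u~v u∈S
      ... | inj₂ v∈S = let T , CT , m = push S CS (Adj-sym u~v) v∈S in T , CT , Move-swap m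

-- The equivalence

other-vertex : 2 ≤ n → (v : Fin n) → ∃ λ w → v ≢ w
other-vertex (s≤s (s≤s _)) zero    = suc zero , λ ()
other-vertex (s≤s (s≤s _)) (suc v) = zero , λ ()

some-vertex : 2 ≤ n → Fin n
some-vertex (s≤s _) = zero

theorem2 : ∀ {n : ℕ} (G : Graph n) → 2 ≤ n → InF G →
    ∀ (e m : ℕ) → IsEVC G e → IsMVC G m →
    (e ≡ m ⇔ (∀ v → ¬ CutVertex G v →
    Σ (Subset n) λ S → MinVC G S × (∀ x → CutVertex G x → x ∈ S) × v ∈ S))
theorem2 {n} G 2≤n G∈F@(conn , _) e m ((C , evc@(covers , sizes , defend) , S₀ , CS₀ , ∣S₀∣≡e) , e-least)
  (M , (M-cover , M-min) , ∣M∣≡m) = mk⇔ only-if if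
  where
  open Graph G using (Adj)

  only-if : e ≡ m → ∀ v → ¬ CutVertex G v →
    Σ (Subset n) λ S → MinVC G S × (∀ x → CutVertex G x → x ∈ S) × v ∈ S
  only-if e≡m v _ = S , minimum S CS , cutVertex∈config G evc minimum S CS , v∈S
    where
    minimum : ∀ S → C S → MinVC G S
    -- All configurations have size `e`, which equals `m` here.
    minimum S CS = covers S CS , λ T T-cover → subst (_≤ ∣ T ∣)
      (trans ∣M∣≡m (trans (sym e≡m) (trans (sym ∣S₀∣≡e) (sizes S₀ S CS₀ CS)))) (M-min T T-cover)

    occupy : Σ (Subset n) λ S → C S × v ∈ S
    occupy with v ∈? S₀ | neighbour G conn (proj₂ (other-vertex 2≤n v))
    ... | yes v∈S₀ | _ = S₀ , CS₀ , v∈S₀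
    -- With `v` empty, the attack on `u v` can only be met by the guard on `u`, which lands on `v`.
    ... | no  v∉S₀ | u , u~v with defend S₀ CS₀ u v u~v
    ...   | S , CS , f , _ , _ , _ , f∈S , inj₁ (u∈S₀ , fu≡v) = S , CS , subst (_∈ S) fu≡v (f∈S u u∈S₀)
    ...   | S , CS , f , _ , _ , _ , f∈S , inj₂ (v∈S₀ , _)    = contradiction v∈S₀ v∉S₀

    S   = proj₁ occupy
    CS  = proj₁ (proj₂ occupy)
    v∈S = proj₂ (proj₂ occupy)

  -- The goal is a decidable equation, so adjacency may be assumed decidable.
  if : (∀ v → ¬ CutVertex G v →
    Σ (Subset n) λ S → MinVC G S × (∀ x → CutVertex G x → x ∈ S) × v ∈ S) → e ≡ m
  if extendable = decidable-stable (e ℕₚ.≟ m) λ e≢m →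
    Adj-decidable λ Adj? → e≢m (ℕₚ.≤-antisym (e≤m Adj?) m≤e)
    where
    Adj-decidable : ¬ ¬ (∀ u v → Dec (Adj u v))
    Adj-decidable = sequence (RawMonad.rawApplicative ¬¬-Monad) (λ u → ¬¬-decidable (Adj u))

    m≤e : m ≤ e
    m≤e = subst (_≤ e) ∣M∣≡m (subst (∣ M ∣ ≤_) ∣S₀∣≡e (M-min S₀ (covers S₀ CS₀)))

    e≤m : (∀ u v → Dec (Adj u v)) → e ≤ m
    e≤m Adj? =
      -- `e-least` needs an actual configuration; a vertex that is not a cut vertex lets
      -- `extendable` produce one.
      let v , ¬cut = non-cut-vertex G conn (proj₂ (other-vertex 2≤n (some-vertex 2≤n)))
          S , S-min , cuts⊆S , _ = extendable v ¬cut
      in subst (e ≤_) ∣M∣≡m (ℕₚ.≤-trans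
           (e-least (MinVC∋Cuts G) (MinVC∋Cuts-EVCClass G Adj? G∈F extendable) S (S-min , cuts⊆S))
           (proj₂ S-min M M-cover))
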